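{- Let $K$ be a Kripke structure over $AP$ and let $\varphi$ be a left-positive $\mathrm{InqLTL}$ formula over $AP$. Then, for each macro-path $\rho$ of $K$, $\rho\models_K\varphi$ (macro-path semantics) if and only if $\mathrm{Paths}_K(\rho)\models_K\varphi$ (team semantics).
   Context: $AP$ is a finite set of atomic propositions. A trace is an infinite word $w$ over $2^{AP}$; for an infinite word $w$, $w(i)$ ($i\ge 0$) is its $(i+1)$-th letter and $w_{\ge i}=w(i)w(i+1)\cdots$. A team is a set $\mathcal L$ of traces, and $\mathcal L_{\ge i}=\{w_{\ge i}\mid w\in\mathcal L\}$. $\mathrm{InqLTL}$ formulas: $\varphi::=\bot\mid p\mid \varphi\vee_b\varphi\mid\varphi\wedge\varphi\mid\varphi\to\varphi\mid \mathsf X\varphi\mid\varphi\,\mathsf U\,\varphi\mid\varphi\,\mathsf R\,\varphi$, with $p\in AP$; $\neg\varphi:=\varphi\to\bot$. Team semantics: $\mathcal L\models\bot$ iff $\mathcal L=\emptyset$; $\mathcal L\models p$ iff $p\in w(0)$ for each $w\in\mathcal L$; $\mathcal L\models\varphi_1\vee_b\varphi_2$ iff $\mathcal L\models\varphi_1$ or $\mathcal L\models\varphi_2$; $\mathcal L\models\varphi_1\wedge\varphi_2$ iff both hold; $\mathcal L\models\varphi_1\to\varphi_2$ iff for all $\mathcal L'\subseteq\mathcal L$, $\mathcal L'\models\varphi_1$ implies $\mathcal L'\models\varphi_2$; $\mathcal L\models\mathsf X\varphi$ iff $\mathcal L_{\ge1}\models\varphi$; $\mathcal L\models\varphi_1\mathsf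 U\varphi_2$ iff for some $i\ge0$, $\mathcal L_{\ge i}\models\varphi_2$ and $\mathcal L_{\ge k}\models\varphi_1$ for all $0\le k<i$; $\mathcal L\models\varphi_1\mathsf R\varphi_2$ iff for each $i\ge0$, $\mathcal L_{\ge i}\models\varphi_2$ or $\mathcal L_{\ge k}\models\varphi_1$ for some $0\le k<i$. Positive formulas: $\psi::=\bot\mid p\mid\neg p\mid\psi\vee_b\psi\mid\psi\wedge\psi\mid\mathsf X\psi\mid\psi\mathsf U\psi\mid\psi\mathsf R\psi$. Left-positive formulas: $\varphi::=\bot\mid p\mid\neg\xi\mid\varphi\vee_b\varphi\mid\varphi\wedge\varphi\mid\psi\to\varphi\mid\mathsf X\varphi\mid\varphi\mathsf U\varphi\mid\varphi\mathsf R\varphi$, with $\xi$ an arbitrary $\mathrm{InqLTL}$ formula and $\psi$ positive. A Kripke structure is $K=\langle S,S_0,R,Lab\rangle$ with $S$ a nonempty set of states, $S_0\subseteq S$, $R\subseteq S\times S$ left-total, $Lab:S\to2^{AP}$; $R[s]=\{s'\mid(s,s')\in R\}$. A path of $K$ is an infinite word $\pi$ over $S$ with $(\pi(i),\pi(i+1))\in R$ for all $i\ge0$; it induces the trace $Lab(\pi(0))Lab(\pi(1))\cdots$. For a set $\Pi$ of paths, $\Pi\models_K\varphi$ means that the team of traces induced by the paths in $\Pi$ satisfies $\varphi$. A macro-state is a (possibly empty) subset of $S$. $S''$ is a successor of $S'$ if each $s'\in S'$ has some $s''\in R[s']\cap S''$, and for each $s''\in S''$ there is $s'\in S'$ with $s''\in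 R[s']$. A macro-path $\rho$ is an infinite sequence of macro-states $\rho(0)\rho(1)\cdots$ with $\rho(i+1)$ a successor of $\rho(i)$ for all $i\ge 0$. $\mathrm{Paths}_K(\rho)$ is the set of paths $\pi$ of $K$ with $\pi(i)\in\rho(i)$ for all $i\ge0$. $\rho\sqsubseteq\rho'$ means $\rho(i)\subseteq\rho'(i)$ for all $i\ge0$. Macro-path semantics: $\rho\models_K\bot$ iff $\mathrm{Paths}_K(\rho)=\emptyset$; $\rho\models_K p$ iff $p\in Lab(s)$ for each $s\in\rho(0)$; $\rho\models_K\varphi_1\vee_b\varphi_2$ iff $\rho\models_K\varphi_1$ or $\rho\models_K\varphi_2$; $\rho\models_K\varphi_1\wedge\varphi_2$ iff both hold; $\rho\models_K\varphi_1\to\varphi_2$ iff for each macro-path $\rho'\sqsubseteq\rho$, $\rho'\models_K\varphi_1$ implies $\rho'\models_K\varphi_2$; $\rho\models_K\mathsf X\varphi$ iff $\rho_{\ge1}\models_K\varphi$; $\rho\models_K\varphi_1\mathsf U\varphi_2$ iff for some $i\ge0$, $\rho_{\ge i}\models_K\varphi_2$ and $\rho_{\ge k}\models_K\varphi_1$ for all $0\le k<i$; $\rho\models_K\varphi_1\mathsf R\varphi_2$ iff for each $i\ge0$, $\rho_{\ge i}\models_K\varphi_2$ or $\rho_{\ge k}\models_K\varphi_1$ for some $0\le k<i$. -}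

module Defs where

open import Level using (Level; Lift) renaming (suc to lsuc)
open import Data.Nat using (ℕ; suc; _+_; _<_)
open import Data.Fin using (Fin)
open import Data.Fin.Subset using (Subset) renaming (_∈_ to _∈ₛ_)
open import Data.Product using (_×_; ∃-syntax)
open import Data.Sum using (_⊎_)
open import Function using (_∘_)
open import Relation.Binary using (Rel)
open import Relation.Binary.PropositionalEquality using (_≗_)
open import Relation.Unary using (Pred; Empty; _∈_; _⊆_)

private variable
  ℓ : Level
  n : ℕ
  A : Set ℓ

infixr 6 _∧_
infixr 5 _∨b_
infixr 4 _⇒_
infixr 7 _U_ _R_
infix  8 ~_

-- Infinite words over A are functions ℕ → A, identified up to pointwise
-- equality _≗_.

Word : Set ℓ → Set ℓ
Word A = ℕ → A

suffix : ℕ → Word A → Word A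
suffix i w j = w (i + j)

-- The finite set AP is Fin n, so that 2^AP is Subset n.

Trace : ℕ → Set
Trace n = Word (Subset n)

-- A team need not be closed under _≗_: satisfaction of a formula depends only
-- on the closure of the team.

Team : (ℓ : Level) → ℕ → Set (lsuc ℓ)
Team ℓ n = Pred (Trace n) ℓ

_≥[_] : Team ℓ n → ℕ → Team ℓ n
(L ≥[ i ]) v = ∃[ w ] w ∈ L × v ≗ suffix i w

data Formula (n : ℕ) : Set where
  bot                   : Formula n
  atom                  : Fin n → Formula n
  _∨b_ _∧_ _⇒_ _U_ _R_  : Formula n → Formula n → Formula n
  X                     : Formula n → Formula n

~_ : Formula n → Formula n
~ φ = φ ⇒ bot

data Positive {n : ℕ} : Formula n → Set where
  bot   : Positive bot
  atom  : ∀ p → Positive (atom p)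
  ~atom : ∀ p → Positive (~ atom p)
  _∨b_  : ∀ {ψ₁ ψ₂} → Positive ψ₁ → Positive ψ₂ → Positive (ψ₁ ∨b ψ₂)
  _∧_   : ∀ {ψ₁ ψ₂} → Positive ψ₁ → Positive ψ₂ → Positive (ψ₁ ∧ ψ₂)
  X     : ∀ {ψ} → Positive ψ → Positive (X ψ)
  _U_   : ∀ {ψ₁ ψ₂} → Positive ψ₁ → Positive ψ₂ → Positive (ψ₁ U ψ₂)
  _R_   : ∀ {ψ₁ ψ₂} → Positive ψ₁ → Positive ψ₂ → Positive (ψ₁ R ψ₂)

data LeftPositive {n : ℕ} : Formula n → Set where
  bot   : LeftPositive bot
  atom  : ∀ p → LeftPositive (atom p)
  neg   : ∀ ξ → LeftPositive (~ ξ)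
  _∨b_  : ∀ {φ₁ φ₂} → LeftPositive φ₁ → LeftPositive φ₂ → LeftPositive (φ₁ ∨b φ₂)
  _∧_   : ∀ {φ₁ φ₂} → LeftPositive φ₁ → LeftPositive φ₂ → LeftPositive (φ₁ ∧ φ₂)
  _⇒_   : ∀ {ψ φ} → Positive ψ → LeftPositive φ → LeftPositive (ψ ⇒ φ)
  X     : ∀ {φ} → LeftPositive φ → LeftPositive (X φ)
  _U_   : ∀ {φ₁ φ₂} → LeftPositive φ₁ → LeftPositive φ₂ → LeftPositive (φ₁ U φ₂)
  _R_   : ∀ {φ₁ φ₂} → LeftPositive φ₁ → LeftPositive φ₂ → LeftPositive (φ₁ R φ₂)

-- Implication quantifies over teams, which raises the level by one; Lift only
-- adjusts the levels of the remaining base cases.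

infix 3 _⊨_

_⊨_ : Team ℓ n → Formula n → Set (lsuc ℓ)
_⊨_ {ℓ} L bot       = Lift (lsuc ℓ) (Empty L)
_⊨_ {ℓ} L (atom p)  = Lift (lsuc ℓ) (∀ w → w ∈ L → p ∈ₛ w 0)
L ⊨ φ₁ ∨b φ₂        = (L ⊨ φ₁) ⊎ (L ⊨ φ₂)
L ⊨ φ₁ ∧ φ₂         = (L ⊨ φ₁) × (L ⊨ φ₂)
_⊨_ {ℓ} {n} L (φ₁ ⇒ φ₂) = (L′ : Team ℓ n) → L′ ⊆ L → L′ ⊨ φ₁ → L′ ⊨ φ₂
L ⊨ X φ             = L ≥[ 1 ] ⊨ φ
L ⊨ φ₁ U φ₂         = ∃[ i ] (L ≥[ i ] ⊨ φ₂) × (∀ k → k < i → L ≥[ k ] ⊨ φ₁)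
L ⊨ φ₁ R φ₂         = ∀ i → (L ≥[ i ] ⊨ φ₂) ⊎ (∃[ k ] k < i × (L ≥[ k ] ⊨ φ₁))

record Kripke (ℓ : Level) (n : ℕ) : Set (lsuc ℓ) where
  field
    State     : Set ℓ
    nonempty  : State
    Initial   : Pred State ℓ
    _⟶_       : Rel State ℓ
    leftTotal : ∀ s → ∃[ s′ ] s ⟶ s′
    Lab       : State → Subset n

module _ {ℓ : Level} {n : ℕ} (K : Kripke ℓ n) where
  open Kripke K

  IsPath : Word State → Set ℓ
  IsPath π = ∀ i → π i ⟶ π (suc i)

  inducedTeam : Pred (Word State) ℓ → Team ℓ n
  inducedTeam Π w = ∃[ π ] π ∈ Π × w ≗ Lab ∘ π

  MacroState : Set (lsuc ℓ)
  MacroState = Pred State ℓ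

  IsSuccessor : MacroState → MacroState → Set ℓ
  IsSuccessor S′ S″ =
    (∀ s′ → s′ ∈ S′ → ∃[ s″ ] s′ ⟶ s″ × s″ ∈ S″) ×
    (∀ s″ → s″ ∈ S″ → ∃[ s′ ] s′ ∈ S′ × s′ ⟶ s″)

  IsMacroPath : Word MacroState → Set ℓ
  IsMacroPath ρ = ∀ i → IsSuccessor (ρ i) (ρ (suc i))

  Paths : Word MacroState → Pred (Word State) ℓ
  Paths ρ π = IsPath π × (∀ i → π i ∈ ρ i)

  infix 4 _⊑_

  _⊑_ : Word MacroState → Word MacroState → Set ℓ
  ρ ⊑ ρ′ = ∀ i → ρ i ⊆ ρ′ i

  TeamSat : Pred (Word State) ℓ → Formula n → Set (lsuc ℓ)
  TeamSat Π φ = inducedTeam Π ⊨ φ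

  MacroSat : Word MacroState → Formula n → Set (lsuc ℓ)
  MacroSat ρ bot       = Lift (lsuc ℓ) (Empty (Paths ρ))
  MacroSat ρ (atom p)  = Lift (lsuc ℓ) (∀ s → s ∈ ρ 0 → p ∈ₛ Lab s)
  MacroSat ρ (φ₁ ∨b φ₂) = MacroSat ρ φ₁ ⊎ MacroSat ρ φ₂
  MacroSat ρ (φ₁ ∧ φ₂) = MacroSat ρ φ₁ × MacroSat ρ φ₂
  MacroSat ρ (φ₁ ⇒ φ₂) =
    ∀ ρ′ → IsMacroPath ρ′ → ρ′ ⊑ ρ → MacroSat ρ′ φ₁ → MacroSat ρ′ φ₂
  MacroSat ρ (X φ)     = MacroSat (suffix 1 ρ) φ
  MacroSat ρ (φ₁ U φ₂) =
    ∃[ i ] MacroSat (suffix i ρ) φ₂ × (∀ k → k < i → MacroSat (suffix k ρ) φ₁)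
  MacroSat ρ (φ₁ R φ₂) =
    ∀ i → MacroSat (suffix i ρ) φ₂ ⊎ (∃[ k ] k < i × MacroSat (suffix k ρ) φ₁)

{-# OPTIONS --safe #-}

-- Satisfaction is downward closed, and Paths ρ commutes with suffixes because a
-- macro-path can be followed backwards as well as forwards, so only implication
-- is delicate; there the question is which macro-paths can stand in for an
-- arbitrary subteam L of the traces of ρ.
-- For ¬ ξ it is enough to refute ξ on single traces, and on macro-paths with at
-- most one state per position the two semantics agree for every formula.
-- For ψ ⇒ φ with ψ positive, take the macro-path ρ′ whose i-th macro-state
-- collects the i-th states of all paths with trace in L. Positive formulas only
-- inspect the letters occurring at each position, so ψ passes from L to ρ′; then
-- φ holds on Paths ρ′, hence on the smaller team L.

module Submission where

open import Defs
open import Level using (Level; lift; lower)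
open import Data.Nat using (ℕ; zero; suc; _+_)
open import Data.Nat.Properties using (+-suc)
open import Data.Fin.Subset using () renaming (_∈_ to _∈ₛ_)
open import Data.Product using (_×_; _,_; ∃-syntax; proj₁; proj₂)
import Data.Product as Product
open import Data.Product.Function.NonDependent.Propositional using (_×-⇔_)
import Data.Sum as Sum
open import Data.Sum.Function.Propositional using (_⊎-⇔_)
open import Function using (_⇔_; mk⇔; Equivalence; _∘_; id)
open import Relation.Binary.PropositionalEquality
  using (_≡_; _≗_; refl; sym; trans; cong; subst)
open import Relation.Unary using (_∈_; _⊆_)

open Equivalence using (to; from)

private variable
  ℓ : Level
  n : ℕ

-- Teams up to pointwise equality; downward closure.

infix 4 _≼_

-- Inclusion up to _≗_: L lies in the closure of M.
_≼_ : Team ℓ n → Team ℓ n → Set ℓ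
L ≼ M = ∀ {v} → v ∈ L → ∃[ w ] w ∈ M × v ≗ w

≼-suffix : {L M : Team ℓ n} → L ≼ M → ∀ i → L ≥[ i ] ≼ M ≥[ i ]
≼-suffix L≼M i {v} (u , u∈L , v≗u) with L≼M u∈L
... | w , w∈M , u≗w = v , (w , w∈M , λ j → trans (v≗u j) (u≗w (i + j))) , λ _ → refl

-- With `≼` in place of `⊆`, one induction gives both downward closure and invariance under `≗`. The
-- implication case needs care: a subteam of `L` need not be a subteam of `M`.
⊨-antitone : {L M : Team ℓ n} (φ : Formula n) → L ≼ M → M ⊨ φ → L ⊨ φ
⊨-antitone bot L≼M (lift ∅) = lift λ v v∈L → ∅ _ (proj₁ (proj₂ (L≼M v∈L)))
⊨-antitone (atom p) L≼M (lift h) = lift λ v v∈L →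
  let w , w∈M , v≗w = L≼M v∈L in subst (p ∈ₛ_) (sym (v≗w 0)) (h w w∈M)
⊨-antitone (φ₁ ∨b φ₂) L≼M = Sum.map (⊨-antitone φ₁ L≼M) (⊨-antitone φ₂ L≼M)
⊨-antitone (φ₁ ∧ φ₂) L≼M = Product.map (⊨-antitone φ₁ L≼M) (⊨-antitone φ₂ L≼M)
⊨-antitone {ℓ} {n} {L} {M} (φ₁ ⇒ φ₂) L≼M h L′ L′⊆L L′⊨φ₁ =
  ⊨-antitone φ₂ L′≼M′ (h M′ proj₁ (⊨-antitone φ₁ M′≼L′ L′⊨φ₁))
  where
  -- A copy of `L′` made of members of `M`: a literal subteam of `M` that is `≼`-equivalent to `L′`.
  M′ : Team ℓ n
  M′ w = w ∈ M × (∃[ v ] v ∈ L′ × w ≗ v)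

  M′≼L′ : M′ ≼ L′
  M′≼L′ = proj₂

  L′≼M′ : L′ ≼ M′
  L′≼M′ {v} v∈L′ with L≼M (L′⊆L v∈L′)
  ... | w , w∈M , v≗w = w , (w∈M , v , v∈L′ , sym ∘ v≗w) , v≗w
⊨-antitone (φ₁ U φ₂) L≼M (i , h₂ , h₁) =
  i , ⊨-antitone φ₂ (≼-suffix L≼M i) h₂ ,
  λ k k<i → ⊨-antitone φ₁ (≼-suffix L≼M k) (h₁ k k<i)
⊨-antitone (φ₁ R φ₂) L≼M h i =
  Sum.map (⊨-antitone φ₂ (≼-suffix L≼M i))
          (λ (k , k<i , h₁) → k , k<i , ⊨-antitone φ₁ (≼-suffix L≼M k) h₁)
          (h i)
⊨-antitone (X φ) L≼M = ⊨-antitone φ (≼-suffix L≼M 1)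

module _ (K : Kripke ℓ n) where
  open Kripke K

  private variable
    ρ σ : Word (MacroState K)

  -- Paths through macro-paths and their suffixes.

  traces : Word (MacroState K) → Team ℓ n
  traces ρ = inducedTeam K (Paths K ρ)

  traces-mono : _⊑_ K σ ρ → traces σ ⊆ traces ρ
  traces-mono σ⊑ρ (π , (path , π∈σ) , w≗π) =
    π , (path , λ i → σ⊑ρ i (π∈σ i)) , w≗π

  suffix-macroPath : IsMacroPath K ρ → ∀ i → IsMacroPath K (suffix i ρ)
  suffix-macroPath {ρ} mp i j =
    subst (IsSuccessor K (ρ (i + j)) ∘ ρ) (sym (+-suc i j)) (mp (i + j))

  suffix-path : ∀ {π} → π ∈ Paths K ρ → ∀ i → suffix i π ∈ Paths K (suffix i ρ)
  suffix-path {ρ} {π} (path , π∈ρ) i =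
    (λ j → subst (λ k → π (i + j) ⟶ π k) (sym (+-suc i j)) (path (i + j))) ,
    λ j → π∈ρ (i + j)

  -- The forward half of `IsSuccessor` already carries a chosen successor, so iterating it yields
  -- the infinite path.
  path-from : IsMacroPath K ρ → ∀ {s} → s ∈ ρ 0 → ∃[ π ] π ∈ Paths K ρ × π 0 ≡ s
  path-from {ρ} mp {s} s∈ρ =
    proj₁ ∘ run , ((λ i → proj₁ (proj₂ (next i (run i)))) , proj₂ ∘ run) , refl
    where
    next : ∀ i ((s , _) : ∃[ s ] s ∈ ρ i) → ∃[ s′ ] s ⟶ s′ × s′ ∈ ρ (suc i)
    next i (s , s∈) = proj₁ (mp i) s s∈

    run : ∀ i → ∃[ s ] s ∈ ρ i
    run zero    = s , s∈ρ
    run (suc i) = Product.map₂ proj₂ (next i (run i))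

  -- The backward half of `IsSuccessor` supplies a predecessor, prepended once for each of the `i`
  -- positions.
  extend-path : IsMacroPath K ρ → ∀ i {π} → π ∈ Paths K (suffix i ρ) →
                ∃[ π′ ] π′ ∈ Paths K ρ × suffix i π′ ≗ π
  extend-path mp zero {π} π∈ = π , π∈ , λ _ → refl
  extend-path {ρ} mp (suc i) π∈ with extend-path (suffix-macroPath mp 1) i π∈
  ... | π′ , (path , π′∈) , π′≗π with proj₂ (mp 0) (π′ 0) (π′∈ 0)
  ...   | s , s∈ρ , s⟶π′0 = π″ , (path″ , π″∈ρ) , π′≗π
    where
    π″ : Word State
    π″ zero    = s
    π″ (suc j) = π′ j

    path″ : IsPath K π″
    path″ zero    = s⟶π′0
    path″ (suc j) = path j

    π″∈ρ : ∀ j → π″ j ∈ ρ j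
    π″∈ρ zero    = s∈ρ
    π″∈ρ (suc j) = π′∈ j

  traces-suffix-≼ : ∀ i → traces ρ ≥[ i ] ≼ traces (suffix i ρ)
  traces-suffix-≼ {ρ} i {v} (w , (π , π∈ρ , w≗π) , v≗w) =
    v , (suffix i π , suffix-path {ρ} π∈ρ i , λ j → trans (v≗w j) (w≗π (i + j))) , λ _ → refl

  traces-suffix-≽ : IsMacroPath K ρ → ∀ i → traces (suffix i ρ) ≼ traces ρ ≥[ i ]
  traces-suffix-≽ mp i {v} (π , π∈ , v≗π) with extend-path mp i π∈
  ... | π′ , π′∈ρ , π′≗π =
    v , (Lab ∘ π′ , (π′ , π′∈ρ , λ _ → refl) ,
         λ j → trans (v≗π j) (cong Lab (sym (π′≗π j)))) ,
    λ _ → refl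

  -- Agreement of the two semantics, connective by connective.

  Agree : Word (MacroState K) → Formula n → Set _
  Agree ρ φ = MacroSat K ρ φ ⇔ TeamSat K (Paths K ρ) φ

  agree-bot : Agree ρ bot
  agree-bot = mk⇔
    (λ (lift ∅) → lift λ _ (π , π∈ρ , _) → ∅ π π∈ρ)
    (λ (lift ∅) → lift λ π π∈ρ → ∅ _ (π , π∈ρ , λ _ → refl))

  -- The team sees only states lying on paths; `path-from` puts every state of `ρ 0` on one.
  agree-atom : IsMacroPath K ρ → ∀ p → Agree ρ (atom p)
  agree-atom mp p = mk⇔
    (λ (lift h) → lift λ _ (π , (_ , π∈ρ) , w≗π) →
       subst (p ∈ₛ_) (sym (w≗π 0)) (h (π 0) (π∈ρ 0)))
    (λ (lift h) → lift λ s s∈ρ →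
       let π , π∈ρ , π0≡s = path-from mp s∈ρ in
       subst (λ s → p ∈ₛ Lab s) π0≡s (h _ (π , π∈ρ , λ _ → refl)))

  agree-suffix : IsMacroPath K ρ → ∀ i φ → Agree (suffix i ρ) φ →
                 MacroSat K (suffix i ρ) φ ⇔ (traces ρ ≥[ i ] ⊨ φ)
  agree-suffix {ρ} mp i φ a = mk⇔
    (⊨-antitone φ (traces-suffix-≼ {ρ} i) ∘ to a)
    (from a ∘ ⊨-antitone φ (traces-suffix-≽ mp i))

  module _ (mp : IsMacroPath K ρ) (φ₁ φ₂ : Formula n)
           (a₁ : ∀ i → Agree (suffix i ρ) φ₁) (a₂ : ∀ i → Agree (suffix i ρ) φ₂) where
    private
      b₁ = λ i → agree-suffix mp i φ₁ (a₁ i)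
      b₂ = λ i → agree-suffix mp i φ₂ (a₂ i)

    agree-U : Agree ρ (φ₁ U φ₂)
    agree-U = mk⇔
      (λ (i , h₂ , h₁) → i , to   (b₂ i) h₂ , λ k k<i → to   (b₁ k) (h₁ k k<i))
      (λ (i , h₂ , h₁) → i , from (b₂ i) h₂ , λ k k<i → from (b₁ k) (h₁ k k<i))

    agree-R : Agree ρ (φ₁ R φ₂)
    agree-R = mk⇔
      (λ h i → Sum.map (to   (b₂ i)) (Product.map₂ λ {k} → Product.map₂ (to   (b₁ k))) (h i))
      (λ h i → Sum.map (from (b₂ i)) (Product.map₂ λ {k} → Product.map₂ (from (b₁ k))) (h i))

  -- The easy half of implication: every macro-path below `ρ` induces a subteam of the traces of
  -- `ρ`.
  teamSat⇒macroSat-⇒ : ∀ φ₁ φ₂ →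
    (∀ {ρ′} → IsMacroPath K ρ′ → _⊑_ K ρ′ ρ → Agree ρ′ φ₁) →
    (∀ {ρ′} → IsMacroPath K ρ′ → _⊑_ K ρ′ ρ → Agree ρ′ φ₂) →
    TeamSat K (Paths K ρ) (φ₁ ⇒ φ₂) → MacroSat K ρ (φ₁ ⇒ φ₂)
  teamSat⇒macroSat-⇒ φ₁ φ₂ a₁ a₂ h ρ′ mp′ ρ′⊑ρ h₁ =
    from (a₂ mp′ ρ′⊑ρ) (h (traces ρ′) (traces-mono ρ′⊑ρ) (to (a₁ mp′ ρ′⊑ρ) h₁))

  -- Macro-paths with at most one state per position.

  _Thin-along_ : Word (MacroState K) → Word State → Set ℓ
  ρ Thin-along π = ∀ i {s} → s ∈ ρ i → s ≡ π i

  -- Thinness passes to suffixes and to smaller macro-paths, so the induction covers arbitrary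
  -- formulas on both sides of an implication.
  agree-thin : ∀ φ {ρ π} → IsMacroPath K ρ → ρ Thin-along π → Agree ρ φ
  agree-thin bot {ρ} mp thin = agree-bot {ρ}
  agree-thin (atom p) mp thin = agree-atom mp p
  agree-thin (φ₁ ∨b φ₂) mp thin = agree-thin φ₁ mp thin ⊎-⇔ agree-thin φ₂ mp thin
  agree-thin (φ₁ ∧ φ₂) mp thin = agree-thin φ₁ mp thin ×-⇔ agree-thin φ₂ mp thin
  agree-thin (X φ) mp thin =
    agree-suffix mp 1 φ (agree-thin φ (suffix-macroPath mp 1) (λ j → thin (suc j)))
  agree-thin (φ₁ U φ₂) mp thin = agree-U mp φ₁ φ₂
    (λ i → agree-thin φ₁ (suffix-macroPath mp i) (λ j → thin (i + j)))
    (λ i → agree-thin φ₂ (suffix-macroPath mp i) (λ j → thin (i + j)))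
  agree-thin (φ₁ R φ₂) mp thin = agree-R mp φ₁ φ₂
    (λ i → agree-thin φ₁ (suffix-macroPath mp i) (λ j → thin (i + j)))
    (λ i → agree-thin φ₂ (suffix-macroPath mp i) (λ j → thin (i + j)))
  agree-thin (φ₁ ⇒ φ₂) {ρ} {π} mp thin = mk⇔ macroSat⇒teamSat
    (teamSat⇒macroSat-⇒ φ₁ φ₂
      (λ mp′ ρ′⊑ρ → agree-thin φ₁ mp′ (λ i → thin i ∘ ρ′⊑ρ i))
      (λ mp′ ρ′⊑ρ → agree-thin φ₂ mp′ (λ i → thin i ∘ ρ′⊑ρ i)))
    where
    macroSat⇒teamSat : MacroSat K ρ (φ₁ ⇒ φ₂) → TeamSat K (Paths K ρ) (φ₁ ⇒ φ₂)
    macroSat⇒teamSat h L L⊆ρ L⊨φ₁ =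
      ⊨-antitone φ₂ L≼ρ′ (to (agree-thin φ₂ mp′ thin′)
        (h ρ′ mp′ (λ _ → proj₁) (from (agree-thin φ₁ mp′ thin′) (⊨-antitone φ₁ ρ′≼L L⊨φ₁))))
      where
      -- All traces in L coincide, so L is determined by whether it is inhabited.
      ρ′ : Word (MacroState K)
      ρ′ i s = s ∈ ρ i × (∃[ v ] v ∈ L)

      mp′ : IsMacroPath K ρ′
      mp′ i =
        (λ s (s∈ρ , v∈L) → Product.map₂ (Product.map₂ (_, v∈L)) (proj₁ (mp i) s s∈ρ)) ,
        (λ s (s∈ρ , v∈L) → Product.map₂ (Product.map₁ (_, v∈L)) (proj₂ (mp i) s s∈ρ))

      thin′ : ρ′ Thin-along π
      thin′ i = thin i ∘ proj₁

      L≼ρ′ : L ≼ traces ρ′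
      L≼ρ′ {v} v∈L with L⊆ρ v∈L
      ... | σ , (path , σ∈ρ) , v≗σ =
        v , (σ , (path , λ i → σ∈ρ i , v , v∈L) , v≗σ) , λ _ → refl

      ρ′≼L : traces ρ′ ≼ L
      -- Membership in `ρ′ 0` carries a trace of `L`; the path behind it and `σ` both follow `π`, so
      -- their labels agree.
      ρ′≼L (σ , (_ , σ∈ρ′) , w≗σ) with proj₂ (σ∈ρ′ 0)
      ... | v , v∈L with L⊆ρ v∈L
      ...   | τ , (_ , τ∈ρ) , v≗τ = v , v∈L , λ i →
        trans (w≗σ i) (trans (cong Lab (trans (thin′ i (σ∈ρ′ i)) (sym (thin i (τ∈ρ i)))))
                             (sym (v≗τ i)))

  -- Single paths and negation.

  ⟨_⟩ : Word State → Word (MacroState K)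
  ⟨ π ⟩ i s = s ≡ π i

  ⟨⟩-macroPath : ∀ {π} → IsPath K π → IsMacroPath K ⟨ π ⟩
  ⟨⟩-macroPath {π} path i =
    (λ { _ refl → π (suc i) , path i , refl }) , (λ { _ refl → π i , refl , path i })

  macroSat-antitone : ∀ φ → _⊑_ K σ ρ → MacroSat K ρ φ → MacroSat K σ φ
  macroSat-antitone bot σ⊑ρ (lift ∅) =
    lift λ π (path , π∈σ) → ∅ π (path , λ i → σ⊑ρ i (π∈σ i))
  macroSat-antitone (atom p) σ⊑ρ (lift h) = lift λ s → h s ∘ σ⊑ρ 0
  macroSat-antitone (φ₁ ∨b φ₂) σ⊑ρ =
    Sum.map (macroSat-antitone φ₁ σ⊑ρ) (macroSat-antitone φ₂ σ⊑ρ)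
  macroSat-antitone (φ₁ ∧ φ₂) σ⊑ρ =
    Product.map (macroSat-antitone φ₁ σ⊑ρ) (macroSat-antitone φ₂ σ⊑ρ)
  macroSat-antitone (φ₁ ⇒ φ₂) σ⊑ρ h τ mp τ⊑σ = h τ mp (λ i → σ⊑ρ i ∘ τ⊑σ i)
  macroSat-antitone (X φ) σ⊑ρ = macroSat-antitone φ (λ j → σ⊑ρ (suc j))
  macroSat-antitone (φ₁ U φ₂) σ⊑ρ (i , h₂ , h₁) =
    i , macroSat-antitone φ₂ (λ j → σ⊑ρ (i + j)) h₂ ,
    λ k k<i → macroSat-antitone φ₁ (λ j → σ⊑ρ (k + j)) (h₁ k k<i)
  macroSat-antitone (φ₁ R φ₂) σ⊑ρ h i =
    Sum.map (macroSat-antitone φ₂ (λ j → σ⊑ρ (i + j)))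
            (λ (k , k<i , h₁) → k , k<i , macroSat-antitone φ₁ (λ j → σ⊑ρ (k + j)) h₁)
            (h i)

  -- By downward closure, a counterexample to either side shrinks to one path satisfying `ξ`, where
  -- `agree-thin` moves `ξ` between the semantics.
  agree-neg : ∀ ξ → Agree ρ (~ ξ)
  agree-neg {ρ} ξ = mk⇔ macroSat⇒teamSat teamSat⇒macroSat
    where
    macroSat⇒teamSat : MacroSat K ρ (~ ξ) → TeamSat K (Paths K ρ) (~ ξ)
    macroSat⇒teamSat h L L⊆ρ L⊨ξ = lift λ v v∈L →
      let π , (path , π∈ρ) , v≗π = L⊆ρ v∈L
          mpπ = ⟨⟩-macroPath path
          π≼L : traces ⟨ π ⟩ ≼ L
          π≼L = λ (_ , (_ , τ≗π) , w≗τ) →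
            v , v∈L , λ i → trans (w≗τ i) (trans (cong Lab (τ≗π i)) (sym (v≗π i)))
      in lower (h ⟨ π ⟩ mpπ (λ { i refl → π∈ρ i })
                 (from (agree-thin ξ mpπ (λ _ → id)) (⊨-antitone ξ π≼L L⊨ξ)))
               π (path , λ _ → refl)

    -- The two semantics may disagree on ξ, so this direction needs ⟨ π ⟩ as well.
    teamSat⇒macroSat : TeamSat K (Paths K ρ) (~ ξ) → MacroSat K ρ (~ ξ)
    teamSat⇒macroSat h ρ′ _ ρ′⊑ρ ρ′⊨ξ = lift λ π (path , π∈ρ′) →
      let π⊑ρ′ : _⊑_ K ⟨ π ⟩ ρ′
          π⊑ρ′ = λ { i refl → π∈ρ′ i }
      in lower (h (traces ⟨ π ⟩) (traces-mono {⟨ π ⟩} {ρ} (λ i → ρ′⊑ρ i ∘ π⊑ρ′ i))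
                 (to (agree-thin ξ (⟨⟩-macroPath path) (λ _ → id))
                     (macroSat-antitone ξ π⊑ρ′ ρ′⊨ξ)))
               (Lab ∘ π) (π , (path , λ _ → refl) , λ _ → refl)

  -- Positive formulas and letterwise covering.

  infix 4 _CoveredBy_

  -- The witness may change with the position and the state, so a path of `ρ` may mix letters from
  -- different traces of `L`.
  _CoveredBy_ : Word (MacroState K) → Team ℓ n → Set ℓ
  ρ CoveredBy L = ∀ i {s} → s ∈ ρ i → ∃[ w ] w ∈ L × w i ≡ Lab s

  covered-suffix : ∀ {L} → ρ CoveredBy L → ∀ i → suffix i ρ CoveredBy (L ≥[ i ])
  covered-suffix cov i j s∈ρ with cov (i + j) s∈ρ
  ... | w , w∈L , eq = suffix i w , (w , w∈L , λ _ → refl) , eq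

  covered-positive : ∀ {ψ L} → Positive ψ → ρ CoveredBy L → L ⊨ ψ → MacroSat K ρ ψ
  covered-positive bot cov (lift ∅) = lift λ π (_ , π∈ρ) →
    ∅ _ (proj₁ (proj₂ (cov 0 (π∈ρ 0))))
  covered-positive (atom p) cov (lift h) = lift λ s s∈ρ →
    let w , w∈L , eq = cov 0 s∈ρ in subst (p ∈ₛ_) eq (h w w∈L)
  -- A path of `ρ′` would start in a state labelled `p`, hence some trace of `L` starts with `p`;
  -- the subteam of such traces must be empty.
  covered-positive {L = L} (~atom p) cov h ρ′ _ ρ′⊑ρ (lift h′) = lift λ π (_ , π∈ρ′) →
    let w , w∈L , eq = cov 0 (ρ′⊑ρ 0 (π∈ρ′ 0))
        p∈w0 = subst (p ∈ₛ_) (sym eq) (h′ (π 0) (π∈ρ′ 0))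
    in lower (h (λ v → v ∈ L × p ∈ₛ v 0) proj₁ (lift λ _ → proj₂)) w (w∈L , p∈w0)
  covered-positive (ψ₁ ∨b ψ₂) cov = Sum.map (covered-positive ψ₁ cov) (covered-positive ψ₂ cov)
  covered-positive (ψ₁ ∧ ψ₂) cov = Product.map (covered-positive ψ₁ cov) (covered-positive ψ₂ cov)
  covered-positive (X ψ) cov = covered-positive ψ (covered-suffix cov 1)
  covered-positive (ψ₁ U ψ₂) cov (i , h₂ , h₁) =
    i , covered-positive ψ₂ (covered-suffix cov i) h₂ ,
    λ k k<i → covered-positive ψ₁ (covered-suffix cov k) (h₁ k k<i)
  covered-positive (ψ₁ R ψ₂) cov h i =
    Sum.map (covered-positive ψ₂ (covered-suffix cov i))
            (λ (k , k<i , h₁) → k , k<i , covered-positive ψ₁ (covered-suffix cov k) h₁)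
            (h i)

  positive⇒leftPositive : ∀ {ψ : Formula n} → Positive ψ → LeftPositive ψ
  positive⇒leftPositive bot       = bot
  positive⇒leftPositive (atom p)  = atom p
  positive⇒leftPositive (~atom p) = neg (atom p)
  positive⇒leftPositive (ψ₁ ∨b ψ₂) = positive⇒leftPositive ψ₁ ∨b positive⇒leftPositive ψ₂
  positive⇒leftPositive (ψ₁ ∧ ψ₂) = positive⇒leftPositive ψ₁ ∧ positive⇒leftPositive ψ₂
  positive⇒leftPositive (X ψ)     = X (positive⇒leftPositive ψ)
  positive⇒leftPositive (ψ₁ U ψ₂) = positive⇒leftPositive ψ₁ U positive⇒leftPositive ψ₂
  positive⇒leftPositive (ψ₁ R ψ₂) = positive⇒leftPositive ψ₁ R positive⇒leftPositive ψ₂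

  -- The macro-path spanned by a subteam.

  macroHull : Word (MacroState K) → Team ℓ n → Word (MacroState K)
  macroHull ρ L i s =
    ∃[ π ] π ∈ Paths K ρ × (∃[ v ] v ∈ L × v ≗ Lab ∘ π) × π i ≡ s

  -- Each state is stored with a whole path through it, whose neighbouring states serve as successor
  -- and predecessor.
  macroHull-macroPath : ∀ ρ L → IsMacroPath K (macroHull ρ L)
  macroHull-macroPath ρ L i =
    (λ { _ (π , π∈@(path , _) , tr , refl) → π (suc i) , path i , π , π∈ , tr , refl }) ,
    (λ { _ (π , π∈@(path , _) , tr , refl) → π i , (π , π∈ , tr , refl) , path i })

  macroHull-⊑ : ∀ ρ L → _⊑_ K (macroHull ρ L) ρ
  macroHull-⊑ ρ L i (_ , (_ , π∈ρ) , _ , refl) = π∈ρ i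

  macroHull-covered : ∀ ρ L → macroHull ρ L CoveredBy L
  macroHull-covered ρ L i (_ , _ , (v , v∈L , v≗π) , refl) = v , v∈L , v≗π i

  -- The converse inclusion can fail, since a path of the hull may switch between stored paths that
  -- meet.
  ≼-macroHull : ∀ {L} → L ⊆ traces ρ → L ≼ traces (macroHull ρ L)
  ≼-macroHull L⊆ρ {v} v∈L with L⊆ρ v∈L
  ... | π , π∈ρ@(path , _) , v≗π =
    v , (π , (path , λ _ → π , π∈ρ , (v , v∈L , v≗π) , refl) , v≗π) , λ _ → refl

  agree-positive-⇒ : ∀ {ψ} φ → Positive ψ →
    (∀ {ρ′} → IsMacroPath K ρ′ → Agree ρ′ ψ) →
    (∀ {ρ′} → IsMacroPath K ρ′ → Agree ρ′ φ) →
    Agree ρ (ψ ⇒ φ)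
  agree-positive-⇒ {ρ} {ψ} φ ψ⁺ aψ aφ =
    mk⇔ macroSat⇒teamSat (teamSat⇒macroSat-⇒ ψ φ (λ mp _ → aψ mp) (λ mp _ → aφ mp))
    where
    macroSat⇒teamSat : MacroSat K ρ (ψ ⇒ φ) → TeamSat K (Paths K ρ) (ψ ⇒ φ)
    macroSat⇒teamSat h L L⊆ρ L⊨ψ =
      ⊨-antitone φ (≼-macroHull {ρ} {L} L⊆ρ)
        (to (aφ (macroHull-macroPath ρ L))
          (h (macroHull ρ L) (macroHull-macroPath ρ L) (macroHull-⊑ ρ L)
             (covered-positive ψ⁺ (macroHull-covered ρ L) L⊨ψ)))

  -- The recursion is on `φ`: in the case `ψ ⇒ φ` the derivation for `ψ` is rebuilt by
  -- `positive⇒leftPositive`, but `ψ` itself is a subformula.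
  agree-leftPositive : ∀ φ → LeftPositive φ → ∀ {ρ} → IsMacroPath K ρ → Agree ρ φ
  agree-leftPositive bot bot {ρ} mp = agree-bot {ρ}
  agree-leftPositive (atom p) (atom p) mp = agree-atom mp p
  agree-leftPositive (ξ ⇒ bot) (neg ξ) mp = agree-neg ξ
  agree-leftPositive (φ₁ ∨b φ₂) (l₁ ∨b l₂) mp =
    agree-leftPositive φ₁ l₁ mp ⊎-⇔ agree-leftPositive φ₂ l₂ mp
  agree-leftPositive (φ₁ ∧ φ₂) (l₁ ∧ l₂) mp =
    agree-leftPositive φ₁ l₁ mp ×-⇔ agree-leftPositive φ₂ l₂ mp
  agree-leftPositive (ψ ⇒ φ) (ψ⁺ ⇒ l) mp = agree-positive-⇒ φ ψ⁺
    (agree-leftPositive ψ (positive⇒leftPositive ψ⁺)) (agree-leftPositive φ l)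
  agree-leftPositive (X φ) (X l) mp =
    agree-suffix mp 1 φ (agree-leftPositive φ l (suffix-macroPath mp 1))
  agree-leftPositive (φ₁ U φ₂) (l₁ U l₂) mp = agree-U mp φ₁ φ₂
    (λ i → agree-leftPositive φ₁ l₁ (suffix-macroPath mp i))
    (λ i → agree-leftPositive φ₂ l₂ (suffix-macroPath mp i))
  agree-leftPositive (φ₁ R φ₂) (l₁ R l₂) mp = agree-R mp φ₁ φ₂
    (λ i → agree-leftPositive φ₁ l₁ (suffix-macroPath mp i))
    (λ i → agree-leftPositive φ₂ l₂ (suffix-macroPath mp i))

proposition10 : ∀ {ℓ : Level} {n : ℕ} (K : Kripke ℓ n) (φ : Formula n) → LeftPositive φ →
    (ρ : Word (MacroState K)) → IsMacroPath K ρ →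
    MacroSat K ρ φ ⇔ TeamSat K (Paths K ρ) φ
proposition10 K φ l ρ = agree-leftPositive K φ l
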